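{- The running time of the algorithm MULE on an input uncertain graph $\mathcal{G}=(V,E,p)$ with $n=|V|$ vertices and a threshold $0<\alpha<1$ is $O(n\cdot 2^n)$.
   Context: An uncertain graph is a triple $\mathcal{G}=(V,E,p)$, where $V$ is a finite set of vertices, $E$ is a set of undirected edges on $V$ (no self-loops, no multiple edges), and $p:E\to(0,1]$ assigns to each edge its probability of existence, edges existing independently. $\Gamma(u)$ is the set of vertices adjacent to $u$ in $(V,E)$. Vertices are identified with $1,2,\dots,n$; $\max(C)$ is the largest vertex of $C\subseteq V$, with $\max(\emptyset)=0$. Edges $e$ with $p(e)<\alpha$ are removed from $\mathcal{G}$ before the algorithm runs. Algorithm MULE$(\mathcal{G},\alpha)$: set $\hat I=\{(u,1):u\in V\}$ and call Enum$(\emptyset,1,\hat I,\emptyset)$. Procedure Enum$(C,q,I,X)$, where $C\subseteq V$, $q$ is a real number, and $I,X$ are sets of pairs (vertex, real number): 1. If $I=\emptyset$ and $X=\emptyset$, output $C$ and return. 2. For each $(u,r)\in I$, in increasing order of $u$: set $C'=C\cup\{u\}$, $q'=q\cdot r$, $I'=\mathrm{GenerateI}(C',q',I)$, $X'=\mathrm{GenerateX}(C',q',X)$; call Enum$(C',q',I',X')$; then replace $X$ by $X\cup\{(u,r)\}$. GenerateI$(C',q',I)$: with $m=\max(C')$ and $S=\{u:(u,r)\in I\}\cap\Gamma(m)$, loop over all $(u,r)\in I$ and return the set of pairs $(u,\,r\cdot p(\{u,m\}))$ over those with $u>m$, $u\in S$ and $q'\cdot r\cdot p(\{u,m\})\ge\alpha$.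 GenerateX$(C',q',X)$: with $m=\max(C')$ and $S=\{v:(v,s)\in X\}\cap\Gamma(m)$, loop over all $(v,s)\in X$ and return the set of pairs $(v,\,s\cdot p(\{v,m\}))$ over those with $v\in S$ and $q'\cdot s\cdot p(\{v,m\})\ge\alpha$. Cost model: arithmetic operations and comparisons on real numbers, looking up the probability $p(e)$ of an edge, testing emptiness of a set and inserting one element into a set each take $O(1)$ time; intersecting two sets of vertices, or copying a set of vertices, takes $O(n)$ time. -}

module Defs where

open import Algebra.Bundles using (CommutativeRing)
open import Data.Bool.Base using (if_then_else_; _∧_)
open import Data.Fin.Base using (Fin; zero; suc; _≤_)
open import Data.Fin.Properties using (_<?_)
open import Data.Fin.Subset
  using (Subset; ⁅_⁆; _∪_; _∩_; ⋃; _∈_; Nonempty; ⊥)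
open import Data.Fin.Subset.Properties
  using (_∈?_; nonempty?; x∈⁅x⁆; q⊆p∪q; x∈p∩q⁻)
open import Data.List.Base using (List; []; _∷_; [_]; _++_; map; null; length; allFin)
open import Data.List.Membership.Propositional using () renaming (_∈_ to _∈ₗ_)
open import Data.List.Relation.Binary.Subset.Propositional using () renaming (_⊆_ to _⊆ₗ_)
open import Data.List.Relation.Unary.Any using (here; there)
open import Data.Maybe.Base using (Maybe; just; nothing)
import Data.Nat.Base as ℕ
open import Data.Nat.Base using (ℕ; _+_)
open import Data.Nat.Induction using (Acc; acc; <-wellFounded)
import Data.Nat.Properties as ℕₚ
open import Data.Product.Base using (∃; ∃₂; Σ-syntax; _×_; _,_; proj₁; proj₂)
open import Data.Unit.Base using (⊤; tt)
open import Data.Vec.Base using ([]; _∷_; tabulate; here; there)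
open import Data.Vec.Properties using (lookup∘tabulate; []=⇒lookup)
open import Function.Base using (_∘_; id)
open import Level using (Level; _⊔_) renaming (suc to lsuc)
open import Relation.Binary.Core using (Rel)
open import Relation.Binary.Definitions using (Decidable; Symmetric)
import Relation.Binary.Construct.NonStrictToStrict as ToStrict
open import Relation.Binary.PropositionalEquality using (_≡_; refl; sym; trans)
open import Relation.Binary.Structures using (IsDecTotalOrder)
open import Relation.Nullary using (¬_; yes; no; does; contradiction)

private
  variable
    a b c e ℓ₁ ℓ₂ : Level
    A : Set a
    B : Set b
    n : ℕ

infix 4 _∈O_

_∈O_ : (ℕ → ℕ) → (ℕ → ℕ) → Set
f ∈O g = ∃₂ λ k n₀ → ∀ n → n₀ ℕ.≤ n → f n ℕ.≤ k ℕ.* g n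

-- The standard library has no real numbers.  An arbitrary ordered field with
-- decidable order plays their role: classically ℝ is one, and the only
-- operations performed on reals are multiplication and comparison.

record OrderedField c ℓ₁ ℓ₂ : Set (lsuc (c ⊔ ℓ₁ ⊔ ℓ₂)) where
  infix 4 _≤ᶠ_
  field
    commutativeRing : CommutativeRing c ℓ₁
  open CommutativeRing commutativeRing public
    renaming (_+_ to _+ᶠ_; _*_ to _*ᶠ_; refl to ≈-refl; sym to ≈-sym; trans to ≈-trans)
  field
    _≤ᶠ_            : Rel Carrier ℓ₂
    isDecTotalOrder : IsDecTotalOrder _≈_ _≤ᶠ_
    1≉0             : ¬ (1# ≈ 0#)
    inverse         : ∀ x → ¬ (x ≈ 0#) → ∃ λ y → x *ᶠ y ≈ 1#
    +-monoˡ-≤       : ∀ z {x y} → x ≤ᶠ y → x +ᶠ z ≤ᶠ y +ᶠ z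
    *-nonNeg        : ∀ {x y} → 0# ≤ᶠ x → 0# ≤ᶠ y → 0# ≤ᶠ x *ᶠ y

  open IsDecTotalOrder isDecTotalOrder public
    using () renaming (_≤?_ to _≤ᶠ?_; ≤-respʳ-≈ to ≤ᶠ-respʳ-≈)
  open ToStrict _≈_ _≤ᶠ_ public using () renaming (_<_ to _<ᶠ_)

-- The vertices 1, …, n are represented, in the same order, by Fin n.

record UncertainGraph (ℝ : OrderedField c ℓ₁ ℓ₂) (n : ℕ) (e : Level)
       : Set (c ⊔ ℓ₁ ⊔ ℓ₂ ⊔ lsuc e) where
  open OrderedField ℝ hiding (_-_)
  infix 4 _~_ _~?_
  field
    _~_     : Rel (Fin n) e
    _~?_    : Decidable _~_
    ~-sym   : Symmetric _~_
    ~-irr   : ∀ {u} → ¬ (u ~ u)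
    p       : ∀ {u v} → u ~ v → Carrier
    p-undir : ∀ {u v} (uv : u ~ v) (vu : v ~ u) → p uv ≈ p vu
    p-pos   : ∀ {u v} (uv : u ~ v) → 0# <ᶠ p uv
    p-≤1    : ∀ {u v} (uv : u ~ v) → p uv ≤ᶠ 1#

  p-irrelevant : ∀ {u v} (uv uv′ : u ~ v) → p uv ≈ p uv′
  p-irrelevant uv uv′ = ≈-trans (p-undir uv (~-sym uv)) (p-undir (~-sym uv) uv′)

  Γ : Fin n → Subset n
  Γ u = tabulate λ v → does (u ~? v)

  ∈Γ⇒~ : ∀ {u v} → v ∈ Γ u → u ~ v
  ∈Γ⇒~ {u} {v} v∈Γu
    with u ~? v | trans (sym (lookup∘tabulate (λ w → does (u ~? w)) v)) ([]=⇒lookup v∈Γu)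
  ... | yes uv | _  = uv
  ... | no  _  | ()

prune : {ℝ : OrderedField c ℓ₁ ℓ₂} → OrderedField.Carrier ℝ →
        UncertainGraph ℝ n e → UncertainGraph ℝ n (e ⊔ ℓ₂)
prune {ℝ = ℝ} α 𝒢 = record
  { _~_     = λ u v → Σ[ uv ∈ u ~ v ] α ≤ᶠ p uv
  ; _~?_    = kept?
  ; ~-sym   = λ (uv , α≤p) → ~-sym uv , ≤ᶠ-respʳ-≈ (p-undir uv (~-sym uv)) α≤p
  ; ~-irr   = ~-irr ∘ proj₁
  ; p       = p ∘ proj₁
  ; p-undir = λ uv vu → p-undir (proj₁ uv) (proj₁ vu)
  ; p-pos   = p-pos ∘ proj₁
  ; p-≤1    = p-≤1 ∘ proj₁
  }
  where
  open OrderedField ℝ hiding (_-_)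
  open UncertainGraph 𝒢
  kept? : Decidable λ u v → Σ[ uv ∈ u ~ v ] α ≤ᶠ p uv
  kept? u v with u ~? v
  ... | no ¬uv = no (¬uv ∘ proj₁)
  ... | yes uv with α ≤ᶠ? p uv
  ...   | yes α≤p = yes (uv , α≤p)
  ...   | no  α≰p = no λ (uv′ , α≤p) → α≰p (≤ᶠ-respʳ-≈ (p-irrelevant uv′ uv) α≤p)

-- Elementary operations have arbitrary constant costs; operations on whole
-- vertex sets have costs in O(n) for n vertices.  Membership of a vertex in a
-- set is elementary, and finding the largest element of a set may take O(n).

record CostModel : Set where
  field
    arithmetic comparison lookup emptiness insertion membership : ℕ
    intersection copying maximum : ℕ → ℕ
    intersection-linear : intersection ∈O id
    copying-linear      : copying ∈O id
    maximum-linear      : maximum ∈O id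

record Timed (A : Set a) : Set a where
  constructor _after_
  field
    value : A
    time  : ℕ

open Timed public

pure : A → Timed A
pure x = x after 0

tick : ℕ → Timed ⊤
tick t = tt after t

infixl 1 _>>=_ _>>_

_>>=_ : Timed A → (A → Timed B) → Timed B
m >>= f = value (f (value m)) after (time m + time (f (value m)))

_>>_ : Timed A → Timed B → Timed B
m >> m′ = m >>= λ _ → m′

-- Lets the continuation of a bind know which value it received.
remember : (m : Timed A) → Timed (∃ λ x → x ≡ value m)
remember m = (value m , refl) after time m

-- The algorithm only takes max of C ∪ {u}, so the convention for ∅ is not needed.
max : (C : Subset n) → Nonempty C → Fin n
max (s ∷ C) ne with nonempty? C
... | yes ne′ = suc (max C ne′)
... | no  _   = zero

∈⇒≤max : (C : Subset n) (ne : Nonempty C) {u : Fin n} → u ∈ C → u ≤ max C ne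
∈⇒≤max (s ∷ C) ne {zero}  _ = ℕ.z≤n
∈⇒≤max (s ∷ C) ne {suc u} (there u∈C) with nonempty? C
... | yes ne′ = ℕ.s≤s (∈⇒≤max C ne′ u∈C)
... | no  ¬ne = contradiction (u , u∈C) ¬ne

module _ (cost : CostModel) where
  open CostModel cost

  filterMap : (A → Timed (Maybe B)) → List A → Timed (List B)
  filterMap f [] = do
    tick emptiness
    pure []
  filterMap f (x ∷ xs) = do
    tick emptiness
    just y ← f x
      where nothing → filterMap f xs
    ys ← filterMap f xs
    pure (y ∷ ys)

  length-filterMap-≤ : (f : A → Timed (Maybe B)) (xs : List A) →
                       length (value (filterMap f xs)) ℕ.≤ length xs
  length-filterMap-≤ f [] = ℕ.z≤n
  length-filterMap-≤ f (x ∷ xs) with value (f x)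
  ... | just _  = ℕ.s≤s (length-filterMap-≤ f xs)
  ... | nothing = ℕₚ.m≤n⇒m≤1+n (length-filterMap-≤ f xs)

  length-filterMap-< : (f : A → Timed (Maybe B)) {x : A} {xs : List A} →
                       x ∈ₗ xs → value (f x) ≡ nothing →
                       length (value (filterMap f xs)) ℕ.< length xs
  length-filterMap-< f {x} {_ ∷ xs} (here refl) fx≡nothing with value (f x) | fx≡nothing
  ... | nothing | refl = ℕ.s≤s (length-filterMap-≤ f xs)
  length-filterMap-< f {xs = y ∷ xs} (there x∈xs) fx≡nothing with value (f y)
  ... | just _  = ℕ.s≤s (length-filterMap-< f x∈xs fx≡nothing)
  ... | nothing = ℕₚ.m≤n⇒m≤1+n (length-filterMap-< f x∈xs fx≡nothing)

  module MULE {ℝ : OrderedField c ℓ₁ ℓ₂} (𝒢 : UncertainGraph ℝ n e)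
              (α : OrderedField.Carrier ℝ) where
    open OrderedField ℝ hiding (_-_)
    open UncertainGraph 𝒢

    Entry : Set c
    Entry = Fin n × Carrier

    -- The sets I and X are lists.  Every list I that occurs is in increasing
    -- order of vertices, since the initial one is and generateI keeps the
    -- order; so traversing it from the head is the prescribed loop order.

    vertices : List Entry → Subset n
    vertices I = ⋃ (map (⁅_⁆ ∘ proj₁) I)

    S⊆Γ : (m : Fin n) (I : List Entry) {u : Fin n} → u ∈ vertices I ∩ Γ m → m ~ u
    S⊆Γ m I = ∈Γ⇒~ ∘ proj₂ ∘ x∈p∩q⁻ (vertices I) (Γ m)

    extend : Carrier → (m : Fin n) (S : Subset n) → (∀ {u} → u ∈ S → m ~ u) →
             Entry → Timed (Maybe Entry)
    extend q′ m S S⊆ (u , r) = do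
      tick membership
      yes u∈S ← pure (u ∈? S)
        where no _ → pure nothing
      tick lookup
      let pᵤₘ = p (S⊆ u∈S)
      tick (arithmetic + arithmetic)
      tick comparison
      yes _ ← pure (α ≤ᶠ? (q′ *ᶠ r) *ᶠ pᵤₘ)
        where no _ → pure nothing
      tick arithmetic
      tick insertion
      pure (just (u , r *ᶠ pᵤₘ))

    extendAbove : Carrier → (m : Fin n) (S : Subset n) → (∀ {u} → u ∈ S → m ~ u) →
                  Entry → Timed (Maybe Entry)
    extendAbove q′ m S S⊆ (u , r) = do
      tick comparison
      yes _ ← pure (m <? u)
        where no _ → pure nothing
      extend q′ m S S⊆ (u , r)

    -- Building S copies the vertices of the given set of pairs and intersects
    -- them with Γ m.
    generateI : (C′ : Subset n) → Nonempty C′ → Carrier → List Entry → Timed (List Entry)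
    generateI C′ ne q′ I = do
      tick (maximum n)
      let m = max C′ ne
      tick (copying n + intersection n)
      let S = vertices I ∩ Γ m
      filterMap (extendAbove q′ m S (S⊆Γ m I)) I

    generateX : (C′ : Subset n) → Nonempty C′ → Carrier → List Entry → Timed (List Entry)
    generateX C′ ne q′ X = do
      tick (maximum n)
      let m = max C′ ne
      tick (copying n + intersection n)
      let S = vertices X ∩ Γ m
      filterMap (extend q′ m S (S⊆Γ m X)) X

    extendAbove-≤ : ∀ q′ m S (S⊆ : ∀ {v} → v ∈ S → m ~ v) {u r} → u ≤ m →
                    value (extendAbove q′ m S S⊆ (u , r)) ≡ nothing
    extendAbove-≤ _ m _ _ {u} u≤m with m <? u
    ... | yes m<u = contradiction m<u (ℕₚ.≤⇒≯ u≤m)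
    ... | no  _   = refl

    generateI-shrinks : ∀ C′ ne q′ I {u r} → (u , r) ∈ₗ I → u ∈ C′ →
                        length (value (generateI C′ ne q′ I)) ℕ.< length I
    generateI-shrinks C′ ne q′ I u∈I u∈C′ =
      length-filterMap-< _ u∈I (extendAbove-≤ q′ _ _ _ (∈⇒≤max C′ ne u∈C′))

    -- The result lists the sets output, in order.  Outputs are emitted as they
    -- are found, so only the writing of each C is charged, not the _++_.
    enum : (C : Subset n) (q : Carrier) (I X : List Entry) →
           Acc ℕ._<_ (length I) → Timed (List (Subset n))
    enum-loop : (C : Subset n) (q : Carrier) (I : List Entry) →
                (∀ {k} → k ℕ.< length I → Acc ℕ._<_ k) →
                (us : List Entry) → us ⊆ₗ I → (X : List Entry) → Timed (List (Subset n))

    enum C q I X (acc rs) = do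
      tick (emptiness + emptiness)
      if null I ∧ null X
        then (do tick (copying n)
                 pure [ C ])
        else enum-loop C q I rs I id X

    enum-loop C q I rs []             us⊆I X = do
      tick emptiness
      pure []
    enum-loop C q I rs ((u , r) ∷ us) us⊆I X = do
      tick emptiness
      tick (copying n)
      tick insertion
      let C′   = C ∪ ⁅ u ⁆
          u∈C′ = q⊆p∪q C ⁅ u ⁆ (x∈⁅x⁆ u)
      tick arithmetic
      let q′   = q *ᶠ r
      I′ , I′≡ ← remember (generateI C′ (u , u∈C′) q′ I)
      X′ ← generateX C′ (u , u∈C′) q′ X
      out ← enum C′ q′ I′ X′ (rs (shrinks I′≡ u∈C′))
      tick insertion
      -- u is not a vertex of X here, so consing is set insertion.
      outs ← enum-loop C q I rs us (us⊆I ∘ there) ((u , r) ∷ X)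
      pure (out ++ outs)
      where
      shrinks : ∀ {C′ ne q′ I′} → I′ ≡ value (generateI C′ ne q′ I) → u ∈ C′ →
                length I′ ℕ.< length I
      shrinks refl u∈C′ = generateI-shrinks _ _ _ I (us⊆I (here refl)) u∈C′

    run : Timed (List (Subset n))
    run = do
      tick (n ℕ.* insertion)
      let Î = map (_, 1#) (allFin n)
      enum ⊥ 1# Î [] (<-wellFounded _)

  -- Edges below the threshold are removed before the algorithm starts, so their
  -- removal is not part of its running time.
  mule : {ℝ : OrderedField c ℓ₁ ℓ₂} → UncertainGraph ℝ n e → OrderedField.Carrier ℝ →
         Timed (List (Subset n))
  mule 𝒢 α = MULE.run (prune α 𝒢) α

{-# OPTIONS --safe #-}
module Submission where

-- The elements of I after u are the only ones that survive GenerateI for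
-- C ∪ {u}, because max (C ∪ {u}) ≥ u.  Hence a loop over k remaining candidates
-- makes recursive calls with at most k − 1, k − 2, …, 0 candidates, which gives
-- fewer than 2 ^ k calls in all.  Moreover ∣I∣ + ∣X∣ never exceeds n, so each
-- call contributes O(n) besides its recursive calls.

open import Defs
open import Data.Nat.Base using (ℕ; _*_; _^_; _≤_)
open import Data.Product.Base using (∃₂)
open import Level using (Level)

open import Data.Fin.Base using (Fin)
import Data.Fin.Base as Fin
import Data.Fin.Properties as Finₚ
open import Data.Fin.Subset using (Subset; Nonempty; _∈_; _∪_; ⁅_⁆)
open import Data.Fin.Subset.Properties using (_∈?_; x∈⁅x⁆; q⊆p∪q)
open import Data.List.Base using (List; []; _∷_; _++_; _∷ʳ_; map; length; allFin)
open import Data.List.Properties using (∷ʳ-++; length-map; length-tabulate)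
open import Data.List.Relation.Binary.Subset.Propositional using () renaming (_⊆_ to _⊆ₗ_)
open import Data.List.Relation.Unary.All as All using (All; []; _∷_)
import Data.List.Relation.Unary.All.Properties as Allₚ
open import Data.List.Relation.Unary.AllPairs using (AllPairs; []; _∷_)
import Data.List.Relation.Unary.AllPairs.Properties as AllPairsₚ
open import Data.List.Relation.Unary.Any using (here; there)
open import Data.Maybe.Base using (Maybe; just; nothing)
open import Data.Nat.Base using (suc; _+_; _⊔_; _<_; z≤n; >-nonZero)
open import Data.Nat.Induction using (Acc; acc; <-wellFounded)
open import Data.Nat.Properties
open import Algebra.Properties.CommutativeSemigroup +-commutativeSemigroup using (x∙yz≈yx∙z)
open import Data.Nat.Tactic.RingSolver using (solve-∀)
open import Data.Product.Base using (_,_; proj₁; proj₂)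
open import Function.Base using (id; _∘_; _on_)
open import Relation.Binary.Core using (Rel)
open import Relation.Binary.PropositionalEquality
  using (_≡_; refl; sym; trans; cong; subst)
open import Relation.Nullary using (yes; no)
open import Relation.Unary using (Pred)

private
  variable
    a b c e ℓ₁ ℓ₂ : Level
    A : Set a
    B : Set b
    n : ℕ

-- Closure properties of asymptotic upper bounds.

∈O-+ : ∀ {f g h} → f ∈O h → g ∈O h → (λ n → f n + g n) ∈O h
∈O-+ {f} {g} {h} (k , n₀ , f≤) (l , n₁ , g≤) = k + l , n₀ ⊔ n₁ , λ n n₀⊔n₁≤n → begin
  f n + g n          ≤⟨ +-mono-≤ (f≤ n (m⊔n≤o⇒m≤o n₀ n₁ n₀⊔n₁≤n))
                                 (g≤ n (m⊔n≤o⇒n≤o n₀ n₁ n₀⊔n₁≤n)) ⟩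
  k * h n + l * h n  ≡⟨ *-distribʳ-+ (h n) k l ⟨
  (k + l) * h n      ∎
  where open ≤-Reasoning

∈O-const : ∀ t → (λ _ → t) ∈O id
-- The threshold is 1 because `id` vanishes at 0, where a positive constant exceeds every multiple
-- of it.
∈O-const t = t , 1 , λ n 1≤n → m≤m*n t n {{>-nonZero 1≤n}}

∈O-scale : ∀ t → (λ n → n * t) ∈O id
∈O-scale t = t , 0 , λ n _ → ≤-reflexive (*-comm n t)

∈O-id⇒∈O-*2^ : ∀ {f} → f ∈O id → f ∈O (λ n → n * 2 ^ n)
∈O-id⇒∈O-*2^ {f} (k , n₀ , f≤) = k , n₀ , λ n n₀≤n →
  ≤-trans (f≤ n n₀≤n) (*-monoʳ-≤ k (m≤m*n n (2 ^ n) {{m^n≢0 2 n}}))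

∈O-2^* : ∀ {f g} → f ∈O g → (λ n → 2 ^ n * f n) ∈O (λ n → g n * 2 ^ n)
∈O-2^* {f} {g} (k , n₀ , f≤) = k , n₀ , λ n n₀≤n → begin
  2 ^ n * f n        ≡⟨ *-comm (2 ^ n) (f n) ⟩
  f n * 2 ^ n        ≤⟨ *-monoˡ-≤ (2 ^ n) (f≤ n n₀≤n) ⟩
  k * g n * 2 ^ n    ≡⟨ *-assoc k (g n) (2 ^ n) ⟩
  k * (g n * 2 ^ n)  ∎
  where open ≤-Reasoning

module _ (cost : CostModel) where
  open CostModel cost

  -- Time, length and invariants of `filterMap`.

  module _ (f : A → Timed (Maybe B)) where

    -- Each element costs one emptiness test and one call of `f`; the leading `emptiness` pays for
    -- the final test on the empty list.
    time-filterMap-≤ : ∀ {t} → (∀ x → time (f x) ≤ t) → ∀ xs →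
                       time (filterMap cost f xs) ≤ emptiness + length xs * (emptiness + t)
    time-filterMap-≤ f≤t [] = ≤-refl
    time-filterMap-≤ {t} f≤t (x ∷ xs) with value (f x)
    ... | nothing = begin
      emptiness + (time (f x) + time (filterMap cost f xs))
        ≤⟨ +-monoʳ-≤ emptiness (+-mono-≤ (f≤t x) (time-filterMap-≤ f≤t xs)) ⟩
      emptiness + (t + (emptiness + length xs * (emptiness + t)))
        ≡⟨ rearrange emptiness t (length xs) ⟩
      emptiness + (emptiness + t + length xs * (emptiness + t))
        ∎
      where
      open ≤-Reasoning
      rearrange : ∀ e t l → e + (t + (e + l * (e + t))) ≡ e + (e + t + l * (e + t))
      rearrange = solve-∀
    ... | just _ = begin
      emptiness + (time (f x) + (time (filterMap cost f xs) + 0))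
        ≤⟨ +-monoʳ-≤ emptiness (+-mono-≤ (f≤t x) (+-monoˡ-≤ 0 (time-filterMap-≤ f≤t xs))) ⟩
      emptiness + (t + (emptiness + length xs * (emptiness + t) + 0))
        ≡⟨ rearrange emptiness t (length xs) ⟩
      emptiness + (emptiness + t + length xs * (emptiness + t))
        ∎
      where
      open ≤-Reasoning
      rearrange : ∀ e t l → e + (t + (e + l * (e + t) + 0)) ≡ e + (e + t + l * (e + t))
      rearrange = solve-∀

    -- A rejected prefix leaves no trace in the result. This is how the candidates already processed
    -- drop out of the count in `length-generateI-≤`.
    length-filterMap-++-≤ : ∀ {xs} → All (λ x → value (f x) ≡ nothing) xs → ∀ ys →
                            length (value (filterMap cost f (xs ++ ys))) ≤ length ys
    length-filterMap-++-≤ [] ys = length-filterMap-≤ cost f ys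
    length-filterMap-++-≤ {x ∷ _} (fx≡nothing ∷ fxs) ys with value (f x) | fx≡nothing
    ... | nothing | refl = length-filterMap-++-≤ fxs ys

    All-filterMap⁺ : {P : Pred A ℓ₁} {Q : Pred B ℓ₂} →
                     (∀ {x y} → value (f x) ≡ just y → P x → Q y) →
                     ∀ {xs} → All P xs → All Q (value (filterMap cost f xs))
    All-filterMap⁺ P⇒Q [] = []
    All-filterMap⁺ P⇒Q (_∷_ {x} px pxs) with value (f x) in fx≡
    ... | just _  = P⇒Q fx≡ px ∷ All-filterMap⁺ P⇒Q pxs
    ... | nothing = All-filterMap⁺ P⇒Q pxs

    -- The relation on results may be derived from the inputs they came from, which suits a map that
    -- changes only the real number of an entry.
    AllPairs-filterMap⁺ : {R : Rel A ℓ₁} {S : Rel B ℓ₂} →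
                          (∀ {x y x′ y′} → value (f x) ≡ just x′ → value (f y) ≡ just y′ →
                           R x y → S x′ y′) →
                          ∀ {xs} → AllPairs R xs → AllPairs S (value (filterMap cost f xs))
    AllPairs-filterMap⁺ R⇒S [] = []
    AllPairs-filterMap⁺ R⇒S (_∷_ {x} rx rxs) with value (f x) in fx≡
    ... | just _  = All-filterMap⁺ (R⇒S fx≡) rx ∷ AllPairs-filterMap⁺ R⇒S rxs
    ... | nothing = AllPairs-filterMap⁺ R⇒S rxs

  -- Cost bounds for the procedures and their linearity.

  extendBound : ℕ
  extendBound = membership + (lookup + ((arithmetic + arithmetic)
                  + (comparison + (arithmetic + insertion))))

  -- The summands are nested in the order of the ticks, so that they can be compared one by one. The
  -- bound serves both generators: the vertex comparison made only by `generateI` is charged to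
  -- `generateX` as well.
  generateBound : ℕ → ℕ
  generateBound n = maximum n + ((copying n + intersection n)
                      + (emptiness + n * (emptiness + (comparison + extendBound))))

  callBound : ℕ → ℕ
  callBound n = emptiness + emptiness + copying n

  -- The cost of one loop iteration apart from the recursive call and the remaining iterations.
  iterationBound : ℕ → ℕ
  iterationBound n = emptiness + (copying n + (insertion + (arithmetic
                       + (generateBound n + (generateBound n + insertion)))))

  -- Chosen so that the loop bound is an equality with no candidates left: the last `emptiness` is
  -- the test that ends the loop.
  workBound : ℕ → ℕ
  workBound n = callBound n + iterationBound n + emptiness

  generateBound-linear : generateBound ∈O id
  generateBound-linear =
    ∈O-+ maximum-linear (∈O-+ (∈O-+ copying-linear intersection-linear)
      (∈O-+ (∈O-const emptiness) (∈O-scale (emptiness + (comparison + extendBound)))))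

  workBound-linear : workBound ∈O id
  workBound-linear =
    ∈O-+ (∈O-+
      (∈O-+ (∈O-const (emptiness + emptiness)) copying-linear)
      (∈O-+ (∈O-const emptiness) (∈O-+ copying-linear (∈O-+ (∈O-const insertion)
        (∈O-+ (∈O-const arithmetic) (∈O-+ generateBound-linear
          (∈O-+ generateBound-linear (∈O-const insertion))))))))
      (∈O-const emptiness)

  module _ {ℝ : OrderedField c ℓ₁ ℓ₂} (𝒢 : UncertainGraph ℝ n e)
           (α : OrderedField.Carrier ℝ) where
    open OrderedField ℝ using (Carrier; _*ᶠ_; _≤ᶠ?_)
    open UncertainGraph 𝒢
    open MULE cost 𝒢 α

    -- Cost, size and order of the generated sets.

    _≺_ : Rel Entry _
    _≺_ = Fin._<_ on proj₁

    module _ (q′ : Carrier) (m : Fin n) (S : Subset n) (S⊆ : ∀ {u} → u ∈ S → m ~ u) where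

      time-extend-≤ : ∀ x → time (extend q′ m S S⊆ x) ≤ extendBound
      time-extend-≤ (u , r) with u ∈? S
      ... | no _ = +-monoʳ-≤ membership z≤n
      ... | yes u∈S with α ≤ᶠ? (q′ *ᶠ r) *ᶠ p (S⊆ u∈S)
      ...   | no _ =
        +-monoʳ-≤ membership (+-monoʳ-≤ lookup (+-monoʳ-≤ (arithmetic + arithmetic)
          (+-monoʳ-≤ comparison z≤n)))
      ...   | yes _ =
        +-monoʳ-≤ membership (+-monoʳ-≤ lookup (+-monoʳ-≤ (arithmetic + arithmetic)
          (+-monoʳ-≤ comparison (+-monoʳ-≤ arithmetic
            (≤-reflexive (+-identityʳ insertion))))))

      time-extendAbove-≤ : ∀ x → time (extendAbove q′ m S S⊆ x) ≤ comparison + extendBound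
      time-extendAbove-≤ (u , r) with m Finₚ.<? u
      ... | no _  = +-monoʳ-≤ comparison z≤n
      ... | yes _ = +-monoʳ-≤ comparison (time-extend-≤ (u , r))

      extend-vertex : ∀ x {y} → value (extend q′ m S S⊆ x) ≡ just y → proj₁ y ≡ proj₁ x
      extend-vertex (u , r) eq with u ∈? S
      extend-vertex (u , r) () | no _
      ... | yes u∈S with α ≤ᶠ? (q′ *ᶠ r) *ᶠ p (S⊆ u∈S)
      extend-vertex (u , r) ()   | yes _ | no _
      extend-vertex (u , r) refl | yes _ | yes _ = refl

      extendAbove-vertex : ∀ x {y} → value (extendAbove q′ m S S⊆ x) ≡ just y →
                           proj₁ y ≡ proj₁ x
      extendAbove-vertex (u , r) eq with m Finₚ.<? u
      extendAbove-vertex (u , r) () | no _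
      ... | yes _ = extend-vertex (u , r) eq

    module _ (C : Subset n) (ne : Nonempty C) (q′ : Carrier) where

      time-generateI-≤ : ∀ I → length I ≤ n → time (generateI C ne q′ I) ≤ generateBound n
      time-generateI-≤ I ∣I∣≤n =
        +-monoʳ-≤ (maximum n) (+-monoʳ-≤ (copying n + intersection n) (≤-trans
          (time-filterMap-≤ _ (time-extendAbove-≤ q′ (max C ne) _ (S⊆Γ (max C ne) I)) I)
          (+-monoʳ-≤ emptiness (*-monoˡ-≤ _ ∣I∣≤n))))

      time-generateX-≤ : ∀ X → length X ≤ n → time (generateX C ne q′ X) ≤ generateBound n
      time-generateX-≤ X ∣X∣≤n =
        +-monoʳ-≤ (maximum n) (+-monoʳ-≤ (copying n + intersection n) (≤-trans
          (time-filterMap-≤ _ (λ x → ≤-trans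
            (time-extend-≤ q′ (max C ne) _ (S⊆Γ (max C ne) X) x)
            (m≤n+m extendBound comparison)) X)
          (+-monoʳ-≤ emptiness (*-monoˡ-≤ _ ∣X∣≤n))))

      length-generateX-≤ : ∀ X → length (value (generateX C ne q′ X)) ≤ length X
      length-generateX-≤ X = length-filterMap-≤ cost _ X

      -- The vertices of `ps` and `u` itself are at most `u`, hence at most `max C`, so
      -- `extendAbove` rejects them all and only entries of `us` can survive. Termination needed
      -- just a strict decrease; the exponential count needs this sharper bound.
      length-generateI-≤ : ∀ {u r} ps us → u ∈ C → All (_≺ (u , r)) ps →
                           length (value (generateI C ne q′ (ps ++ (u , r) ∷ us))) ≤ length us
      length-generateI-≤ {u} {r} ps us u∈C ps≺u =
        -- Reassociating puts `u` at the end of the rejected prefix.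
        subst (λ I → length (value (filterMap cost f I)) ≤ length us) (∷ʳ-++ ps (u , r) us)
          (length-filterMap-++-≤ f (Allₚ.∷ʳ⁺ (All.map (below ∘ <⇒≤) ps≺u) (below ≤-refl)) us)
        where
        m : Fin n
        m = max C ne
        I₀ : List Entry
        I₀ = ps ++ (u , r) ∷ us
        f : Entry → Timed (Maybe Entry)
        f = extendAbove q′ m _ (S⊆Γ m I₀)
        below : ∀ {x} → proj₁ x Fin.≤ u → value (f x) ≡ nothing
        below x≤u = extendAbove-≤ q′ m _ (S⊆Γ m I₀) (≤-trans x≤u (∈⇒≤max C ne u∈C))

      -- Carries the order of `I` into the recursive call, where it again places the processed
      -- candidates below the current one.
      generateI-increasing : ∀ {I} → AllPairs _≺_ I →
                             AllPairs _≺_ (value (generateI C ne q′ I))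
      generateI-increasing {I} = AllPairs-filterMap⁺ _ preserved
        where
        m : Fin n
        m = max C ne
        f : Entry → Timed (Maybe Entry)
        f = extendAbove q′ m _ (S⊆Γ m I)
        preserved : ∀ {x y x′ y′} → value (f x) ≡ just x′ → value (f y) ≡ just y′ →
                    x ≺ y → x′ ≺ y′
        preserved {x} {y} fx fy x≺y
          rewrite extendAbove-vertex q′ m _ (S⊆Γ m I) x fx
                | extendAbove-vertex q′ m _ (S⊆Γ m I) y fy = x≺y

    -- Exponential bound for the recursion.

    emptiness-≤-callBound : ∀ t →
      iterationBound n + ((emptiness + emptiness) + t) ≤ (callBound n + iterationBound n) + t
    -- A call that enters the loop pays only for two emptiness tests; the slack is the copy made on
    -- output.
    emptiness-≤-callBound t = ≤-trans
      (≤-reflexive (x∙yz≈yx∙z (iterationBound n) (emptiness + emptiness) t))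
      (+-monoˡ-≤ t (+-monoˡ-≤ (iterationBound n) (m≤m+n (emptiness + emptiness) (copying n))))

    -- With E(k) and L(k) the times of enum and of its loop on k candidates, the
    -- terms added to them turn E(k) ≤ callBound + L(k) and
    -- L(k+1) ≤ iterationBound + E(k) + L(k) into a mere doubling.
    time-enum-≤ : ∀ C q I X (ac : Acc _<_ (length I)) →
                  AllPairs _≺_ I → length I + length X ≤ n →
                  iterationBound n + time (enum C q I X ac) ≤ 2 ^ length I * workBound n
    -- ps is the part of I that the loop has already processed.
    time-enum-loop-≤ : ∀ C q I (rs : ∀ {k} → k < length I → Acc _<_ k) us (us⊆I : us ⊆ₗ I) X →
                       ∀ ps → I ≡ ps ++ us → All (λ x → All (x ≺_) us) ps →
                       AllPairs _≺_ us → AllPairs _≺_ I →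
                       length I ≤ n → length us + length X ≤ n →
                       (callBound n + iterationBound n) + time (enum-loop C q I rs us us⊆I X)
                         ≤ 2 ^ length us * workBound n

    -- The output case costs exactly `callBound n`; the `emptiness` in `workBound n` is left over.
    time-enum-≤ C q [] [] (acc rs) I↑ ∣I∣+∣X∣≤n = ≤-trans
      (≤-reflexive (rearrange emptiness (copying n) (iterationBound n)))
      (≤-trans (m≤m+n _ emptiness) (≤-reflexive (sym (*-identityˡ _))))
      where
      rearrange : ∀ e c i → i + ((e + e) + (c + 0)) ≡ (e + e + c) + i
      rearrange = solve-∀
    -- Nothing is output here, but the loop still makes its closing emptiness test.
    time-enum-≤ C q [] X@(_ ∷ _) (acc rs) I↑ ∣I∣+∣X∣≤n = ≤-trans
      (emptiness-≤-callBound _)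
      (time-enum-loop-≤ C q [] rs [] id X [] refl [] I↑ I↑ z≤n ∣I∣+∣X∣≤n)
    time-enum-≤ C q I@(_ ∷ _) X (acc rs) I↑ ∣I∣+∣X∣≤n = ≤-trans
      (emptiness-≤-callBound _)
      (time-enum-loop-≤ C q I rs I id X [] refl [] I↑ I↑
        (m+n≤o⇒m≤o (length I) ∣I∣+∣X∣≤n) ∣I∣+∣X∣≤n)

    time-enum-loop-≤ C q I rs [] us⊆I X ps I≡ ps≺us us↑ I↑ ∣I∣≤n ∣us∣+∣X∣≤n =
      ≤-reflexive (trans
        (cong (callBound n + iterationBound n +_) (+-identityʳ emptiness))
        (sym (*-identityˡ (workBound n))))
    time-enum-loop-≤ C q I rs ((u , r) ∷ us) us⊆I X ps refl ps≺us (u≺us ∷ us↑) I↑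
                     ∣I∣≤n ∣us∣+∣X∣≤n = begin
      (callBound n + iterationBound n) + (emptiness + (copying n + (insertion + (arithmetic
        + (time genI + (time genX + (time rec + (insertion + (time rest + 0)))))))))
        ≤⟨ +-monoʳ-≤ (callBound n + iterationBound n) (+-monoʳ-≤ emptiness
             (+-monoʳ-≤ (copying n) (+-monoʳ-≤ insertion (+-monoʳ-≤ arithmetic
               (+-mono-≤ (time-generateI-≤ C′ ne q′ I ∣I∣≤n)
                 (+-monoˡ-≤ _ (time-generateX-≤ C′ ne q′ X
                   (m+n≤o⇒n≤o (suc (length us)) ∣us∣+∣X∣≤n)))))))) ⟩
      (callBound n + iterationBound n) + (emptiness + (copying n + (insertion + (arithmetic
        + (generateBound n + (generateBound n + (time rec + (insertion + (time rest + 0)))))))))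
        -- The cost of this iteration adds up to one `iterationBound n`, the surplus required by the
        -- bound for `rec`; the surplus already present goes to `rest`.
        ≡⟨ rearrange (callBound n) emptiness (copying n) insertion arithmetic (generateBound n)
             (time rec) (time rest) ⟩
      (iterationBound n + time rec) + ((callBound n + iterationBound n) + time rest)
        ≤⟨ +-mono-≤ rec≤ rest≤ ⟩
      2 ^ length us * workBound n + 2 ^ length us * workBound n
        ≡⟨ double (2 ^ length us) (workBound n) ⟩
      2 ^ suc (length us) * workBound n
        ∎
      where
      open ≤-Reasoning
      C′ : Subset n
      C′ = C ∪ ⁅ u ⁆
      u∈C′ : u ∈ C′
      u∈C′ = q⊆p∪q C ⁅ u ⁆ (x∈⁅x⁆ u)
      ne : Nonempty C′
      ne = u , u∈C′
      q′ : Carrier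
      q′ = q *ᶠ r
      genI genX : Timed (List Entry)
      genI = generateI C′ ne q′ I
      genX = generateX C′ ne q′ X
      rec rest : Timed (List (Subset n))
      rec  = enum C′ q′ (value genI) (value genX)
               (rs (generateI-shrinks C′ ne q′ I (us⊆I (here refl)) u∈C′))
      rest = enum-loop C q I rs us (us⊆I ∘ there) ((u , r) ∷ X)
      genI-short : length (value genI) ≤ length us
      genI-short = length-generateI-≤ C′ ne q′ ps us u∈C′ (All.map All.head ps≺us)
      -- The hypothesis unfolded: `u` still counts among the candidates. The recursive call loses
      -- it, while the rest of the loop moves it to `X` and keeps the sum.
      ∣us∣+∣X∣<n : suc (length us + length X) ≤ n
      ∣us∣+∣X∣<n = ∣us∣+∣X∣≤n
      rec≤ : iterationBound n + time rec ≤ 2 ^ length us * workBound n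
      rec≤ = ≤-trans
        (time-enum-≤ C′ q′ (value genI) (value genX) (rs _)
          (generateI-increasing C′ ne q′ I↑)
          (≤-trans (+-mono-≤ genI-short (length-generateX-≤ C′ ne q′ X)) (<⇒≤ ∣us∣+∣X∣<n)))
        (*-monoˡ-≤ (workBound n) (^-monoʳ-≤ 2 genI-short))
      rest≤ : (callBound n + iterationBound n) + time rest ≤ 2 ^ length us * workBound n
      -- `u` joins the processed part, and the order of `us` places it below all remaining
      -- candidates.
      rest≤ = time-enum-loop-≤ C q I rs us (us⊆I ∘ there) ((u , r) ∷ X) (ps ∷ʳ (u , r))
        (sym (∷ʳ-++ ps (u , r) us)) (Allₚ.∷ʳ⁺ (All.map All.tail ps≺us) u≺us) us↑ I↑ ∣I∣≤n
        (≤-trans (≤-reflexive (+-suc (length us) (length X))) ∣us∣+∣X∣<n)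
      rearrange : ∀ A e c i a g E L →
        (A + (e + (c + (i + (a + (g + (g + i)))))))
          + (e + (c + (i + (a + (g + (g + (E + (i + (L + 0)))))))))
        ≡ ((e + (c + (i + (a + (g + (g + i)))))) + E)
          + ((A + (e + (c + (i + (a + (g + (g + i))))))) + L)
      rearrange = solve-∀
      double : ∀ k w → k * w + k * w ≡ (2 * k) * w
      double = solve-∀

    -- Running time of the whole algorithm.

    time-run-≤ : time run ≤ n * insertion + 2 ^ n * workBound n
    time-run-≤ = +-monoʳ-≤ (n * insertion) (≤-trans
      -- The surplus `iterationBound n`, there only for the induction, is discarded.
      (m+n≤o⇒n≤o (iterationBound n) (time-enum-≤ _ _ Î [] (<-wellFounded _)
        (AllPairsₚ.map⁺ (AllPairsₚ.tabulate⁺-< id))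
        (≤-reflexive (trans (+-identityʳ (length Î)) ∣Î∣≡n))))
      (≤-reflexive (cong (λ k → 2 ^ k * workBound n) ∣Î∣≡n)))
      where
      Î : List Entry
      Î = map (_, _) (allFin n)
      ∣Î∣≡n : length Î ≡ n
      ∣Î∣≡n = trans (length-map _ (allFin n)) (length-tabulate id)

theorem3 : ∀ {c ℓ₁ ℓ₂ e : Level} (ℝ : OrderedField c ℓ₁ ℓ₂) (cost : CostModel) →
    let open OrderedField ℝ in
    ∃₂ λ (k n₀ : ℕ) → ∀ (n : ℕ) → n₀ ≤ n →
    ∀ (𝒢 : UncertainGraph ℝ n e) (α : Carrier) → 0# <ᶠ α → α <ᶠ 1# →
    time (mule cost 𝒢 α) ≤ k * (n * 2 ^ n)
theorem3 ℝ cost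
  -- The summands are the insertions that build the initial set and the recursion. Both constants
  -- depend on `cost` alone, so they are uniform in the graph and the threshold.
  with k , n₀ , bound ← ∈O-+ (∈O-id⇒∈O-*2^ (∈O-scale (CostModel.insertion cost)))
                             (∈O-2^* (workBound-linear cost))
  = k , n₀ , λ n n₀≤n 𝒢 α _ _ → ≤-trans (time-run-≤ cost (prune α 𝒢) α) (bound n n₀≤n)
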